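{- For every $n$, there is a bijection between $\bar{Q}_4(0,n)$ and $P_7(0,n)$.
   Context: Partitions: $\ell(\mu)$ is the number of parts, $s(\mu)$ the smallest part ($s(\emptyset)=+\infty$), $\mu_i=0$ if $\mu$ has fewer than $i$ parts, rank of $\lambda$ is $\lambda_1-\ell(\lambda)$. The rank-set of $\lambda=(\lambda_1\ge\cdots\ge\lambda_\ell>0)$ is $[-\lambda_1,1-\lambda_2,\ldots,\ell-1-\lambda_\ell,\ell,\ell+1,\ldots]$. The Durfee symbol of $\lambda$ is $(\alpha,\beta)_j$, where $j$ is the side of the Durfee square (largest $j$ with $\lambda_j\ge j$, or $0$), $\alpha_i=\lambda'_{j+i}$ are the column lengths to the right of the Durfee square ($\lambda'$ the conjugate) and $\beta=(\lambda_{j+1},\lambda_{j+2},\ldots)$ are the rows below it. $Q(0,n)$ is the set of partitions of $n$ with $0$ in the rank-set; $P(0,n)$ the set of partitions of $n$ with rank $\ge0$. $\bar{Q}_4(0,n)$ is the set of $\lambda\in Q(0,n)$ whose Durfee symbol satisfies $j\ge1$, $\ell(\beta)-\ell(\alpha)\ge1$, $\alpha_1=\alpha_2=j$, $s(\alpha)\ge2$, $\beta_1=\beta_2$ and $s(\beta)=2$. $P_7(0,n)$ is the set of $\mu\in P(0,n)$ whose Durfee symbol $(\gamma,\delta)_{j'}$ satisfies $j'\ge1$, $\ell(\gamma)=\ell(\delta)$, $\gamma_1=j'-1>\gamma_2$, $\delta_1=j'$, and $\delta$ has no part equal to $2$. -}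

module Defs where

open import Data.Nat using (ℕ; zero; suc; _+_; _∸_; _≤ᵇ_; _≡ᵇ_; _<ᵇ_)
open import Data.Nat.Base using (_⊓_)
open import Data.Bool using (Bool; true; false; _∧_; _∨_; not; if_then_else_; T)
open import Data.List using (List; []; _∷_; length; map; filter; upTo; drop; foldr)
open import Data.Nat.ListAction using (sum)

open import Data.Bool.ListAction using (any; all)
open import Data.Maybe using (Maybe; just; nothing)
open import Data.Product using (Σ)
open import Data.Integer as ℤ using (ℤ; +_; _-_)
open import Relation.Nullary.Decidable using (⌊_⌋)

-- A partition is represented by the list of its parts (λ₁ ≥ λ₂ ≥ ⋯ ≥ λ_ℓ > 0).

-- μ_i with 1-based index, μ_i = 0 if μ has fewer than i parts.
part : List ℕ → ℕ → ℕ
part []       _             = 0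
part (x ∷ xs) zero          = 0
part (x ∷ xs) (suc zero)    = x
part (x ∷ xs) (suc (suc i)) = part xs (suc i)

weaklyDecreasing : List ℕ → Bool
weaklyDecreasing []           = true
weaklyDecreasing (x ∷ [])     = true
weaklyDecreasing (x ∷ y ∷ xs) = (y ≤ᵇ x) ∧ weaklyDecreasing (y ∷ xs)

isPartitionOf : ℕ → List ℕ → Bool
isPartitionOf n λs = (sum λs ≡ᵇ n) ∧ all (λ x → 1 ≤ᵇ x) λs ∧ weaklyDecreasing λs

numParts : List ℕ → ℕ
numParts = length

-- s(μ): smallest part, with nothing standing for +∞ (s(∅) = +∞)
smallest : List ℕ → Maybe ℕ
smallest []       = nothing
smallest (x ∷ xs) = just (foldr _⊓_ x xs)

smallestGeq : List ℕ → ℕ → Bool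
smallestGeq μ k with smallest μ
... | nothing = true
... | just m  = k ≤ᵇ m

smallestEq : List ℕ → ℕ → Bool
smallestEq μ k with smallest μ
... | nothing = false
... | just m  = m ≡ᵇ k

rankNonneg : List ℕ → Bool
rankNonneg λs = numParts λs ≤ᵇ part λs 1

-- k belongs to the rank-set [-λ₁, 1-λ₂, …, ℓ-1-λ_ℓ, ℓ, ℓ+1, …]
inRankSet : ℤ → List ℕ → Bool
inRankSet k λs =
  any (λ i → ⌊ k ℤ.≟ ((+ i) - (+ part λs (suc i))) ⌋) (upTo (numParts λs))
  ∨ ⌊ (+ numParts λs) ℤ.≤? k ⌋

conjPart : List ℕ → ℕ → ℕ
conjPart λs i = length (filter (λ x → i Data.Nat.≤? x) λs)

-- side of the Durfee square: largest j with λ_j ≥ j (0 if none)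
durfeeAux : ℕ → List ℕ → ℕ
durfeeAux i []       = 0
durfeeAux i (x ∷ xs) = if suc i ≤ᵇ x then suc (durfeeAux (suc i) xs) else 0

durfee : List ℕ → ℕ
durfee = durfeeAux 0

-- Durfee symbol (α, β)_j
-- α_i = λ'_{j+i}: column lengths to the right of the Durfee square (i = 1 … λ₁ − j)
durfeeα : List ℕ → List ℕ
durfeeα λs = map (λ i → conjPart λs (durfee λs + suc i)) (upTo (part λs 1 ∸ durfee λs))

durfeeβ : List ℕ → List ℕ
durfeeβ λs = drop (durfee λs) λs

inQ0 : ℕ → List ℕ → Bool
inQ0 n λs = isPartitionOf n λs ∧ inRankSet (+ 0) λs

inP0 : ℕ → List ℕ → Bool
inP0 n μ = isPartitionOf n μ ∧ rankNonneg μ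

inQbar4 : ℕ → List ℕ → Bool
inQbar4 n λs =
  inQ0 n λs
  ∧ (1 ≤ᵇ j)
  ∧ (suc (numParts α) ≤ᵇ numParts β)
  ∧ (part α 1 ≡ᵇ j) ∧ (part α 2 ≡ᵇ j)
  ∧ smallestGeq α 2
  ∧ (part β 1 ≡ᵇ part β 2)
  ∧ smallestEq β 2
  where
    j = durfee λs
    α = durfeeα λs
    β = durfeeβ λs

inP7 : ℕ → List ℕ → Bool
inP7 n μ =
  inP0 n μ
  ∧ (1 ≤ᵇ j′)
  ∧ (numParts γ ≡ᵇ numParts δ)
  ∧ (part γ 1 ≡ᵇ j′ ∸ 1) ∧ (part γ 2 <ᵇ part γ 1)
  ∧ (part δ 1 ≡ᵇ j′)
  ∧ not (any (λ x → x ≡ᵇ 2) δ)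
  where
    j′ = durfee μ
    γ = durfeeα μ
    δ = durfeeβ μ

-- The sets as types (membership is a Bool, so proofs are irrelevant)
Qbar4 : ℕ → Set
Qbar4 n = Σ (List ℕ) (λ λs → T (inQbar4 n λs))

P7 : ℕ → Set
P7 n = Σ (List ℕ) (λ μ → T (inP7 n μ))

module Submission where

-- A partition λ with Durfee square of side j is determined by its Durfee symbol (α, β)_j,
-- through λᵢ = j + α′ᵢ for i ≤ j, and |λ| = j² + |α| + |β|.  Since 0 lies in the rank-set of λ
-- exactly when λ_{j+1} = j, membership in Q̄₄(0,n) says that α = (j, j, A) and β = (j, j, B, 2)
-- with all parts of A and B in [2, j] and ℓ(A) ≤ ℓ(B).  Membership in P₇(0,n) says that the
-- Durfee side is j + 1, γ = (j, G) and δ = (j + 1, D) with the parts of G in [1, j − 1], those of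
-- D in [1, j + 1] ∖ {2}, and ℓ(G) = ℓ(D) (which already makes the rank 0).  The bijection takes
-- G = B − 1 partwise and D = A + 1 partwise padded with 1s to length ℓ(B); its inverse drops the
-- 1s of D and decreases the other parts.  Both symbols have size j² + 4j + 2 + |A| + |B|.

open import Defs
open import Data.Bool using (Bool; true; false; _∧_; not; T)
open import Data.Bool.ListAction using (any)
open import Data.Bool.Properties using (T-∧; T-∨; T-irrelevant)
import Data.Integer as ℤ
import Data.Integer.Properties as ℤ
open import Data.List using (List; []; _∷_; length; map; filter; foldr; upTo; drop; applyUpTo; replicate; _++_; _∷ʳ_; initLast; _∷ʳ′_)
open import Data.List.Membership.Propositional using (lose)
open import Data.List.Membership.Propositional.Properties using (∈-upTo⁺)
open import Data.List.Properties using (length-map; length-++; length-replicate; length-filter; length-applyUpTo; filter-accept; filter-reject; filter-none; filter-all; filter-++; map-upTo; map-cong; map-∘; map-id; ++-identityʳ)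
open import Data.List.Relation.Unary.All using (All; []; _∷_)
import Data.List.Relation.Unary.All as All
import Data.List.Relation.Unary.All.Properties as All
open import Data.List.Relation.Unary.AllPairs using (AllPairs; []; _∷_)
import Data.List.Relation.Unary.AllPairs as AllPairs
import Data.List.Relation.Unary.AllPairs.Properties as AllPairs
open import Data.List.Relation.Unary.Any using (satisfied)
import Data.List.Relation.Unary.Any.Properties as Any
open import Data.List.Relation.Unary.Linked using (Linked; []; [-]; _∷_)
open import Data.List.Relation.Unary.Linked.Properties using (AllPairs⇒Linked; Linked⇒AllPairs)
open import Data.Nat using (ℕ; zero; suc; _+_; _*_; _∸_; _≤_; _<_; _≥_; _≤ᵇ_; _≡ᵇ_; z≤n; s≤s; z<s; s<s; s≤s⁻¹; s<s⁻¹; _≤?_; _⊓_; pred)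
open import Data.Nat.ListAction using (sum)
open import Data.Nat.ListAction.Properties using (sum-++)
open import Data.Nat.Properties
open import Algebra.Properties.CommutativeSemigroup +-commutativeSemigroup using (interchange)
open import Relation.Binary.Properties.Poset ≤-poset using (≥-trans)
open import Data.Nat.Tactic.RingSolver using (solve-∀)
open import Data.Product using (_×_; _,_; proj₂)
open import Data.Product.Properties using (Σ-≡,≡→≡)
open import Data.Sum using (inj₁; inj₂)
open import Function using (_∘_; id)
open import Function.Bundles using (_⇔_; mk⇔; Equivalence; _⤖_; mk↔ₛ′)
open import Function.Construct.Composition using (_⇔-∘_)
open import Function.Properties.Inverse using (↔⇒⤖)
open import Relation.Binary.Definitions using (tri<; tri≈; tri>)
open import Relation.Binary.PropositionalEquality
open import Relation.Nullary using (¬_; yes; no; contradiction)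
open import Relation.Nullary.Decidable using (⌊_⌋; toWitness; fromWitness)
open import Relation.Nullary.Reflects using (ofʸ; ofⁿ)

open Equivalence using (to; from)
open ≡-Reasoning

cong₃ : ∀ {A B C D : Set} (f : A → B → C → D) {a a′ b b′ c c′} →
        a ≡ a′ → b ≡ b′ → c ≡ c′ → f a b c ≡ f a′ b′ c′
cong₃ f refl refl refl = refl

T-∧⁻ : ∀ {a b} → T (a ∧ b) → T a × T b
T-∧⁻ = to T-∧

T-∧⁺ : ∀ {a b} → T a → T b → T (a ∧ b)
T-∧⁺ p q = from T-∧ (p , q)

notAny≡ᵇ⇔All≢ : ∀ k xs → T (not (any (_≡ᵇ k) xs)) ⇔ All (_≢ k) xs
notAny≡ᵇ⇔All≢ k [] = mk⇔ (λ _ → []) (λ _ → _)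
notAny≡ᵇ⇔All≢ k (x ∷ xs) with x ≡ᵇ k in eq
... | true = mk⇔ (λ ()) (λ { (x≢k ∷ _) → x≢k (≡ᵇ⇒≡ x k (subst T (sym eq) _)) })
... | false = mk⇔ (λ t → (λ x≡k → subst T eq (≡⇒≡ᵇ x k x≡k)) ∷ to (notAny≡ᵇ⇔All≢ k xs) t)
                  (λ { (_ ∷ xs≢k) → from (notAny≡ᵇ⇔All≢ k xs) xs≢k })

≤-via-< : ∀ {m n} → (∀ {k} → k < m → k < n) → m ≤ n
≤-via-< {zero} _ = z≤n
≤-via-< {suc m} h = h ≤-refl

+<⇔<∸ : ∀ j {t p} → j + t < p ⇔ t < p ∸ j
+<⇔<∸ zero = mk⇔ id id
+<⇔<∸ (suc j) {p = zero} = mk⇔ (λ ()) (λ ())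
+<⇔<∸ (suc j) {p = suc p} = mk⇔ (to (+<⇔<∸ j) ∘ s<s⁻¹) (s<s ∘ from (+<⇔<∸ j))

-- Descending lists and the parts of a partition

Descending : List ℕ → Set
Descending = AllPairs _≥_

Positive : List ℕ → Set
Positive = All (0 <_)

weaklyDecreasing⇒Linked : ∀ xs → T (weaklyDecreasing xs) → Linked _≥_ xs
weaklyDecreasing⇒Linked [] _ = []
weaklyDecreasing⇒Linked (x ∷ []) _ = [-]
weaklyDecreasing⇒Linked (x ∷ y ∷ xs) t =
  let y≤x , t′ = T-∧⁻ t in ≤ᵇ⇒≤ y x y≤x ∷ weaklyDecreasing⇒Linked (y ∷ xs) t′

Linked⇒weaklyDecreasing : ∀ {xs} → Linked _≥_ xs → T (weaklyDecreasing xs)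
Linked⇒weaklyDecreasing [] = _
Linked⇒weaklyDecreasing [-] = _
Linked⇒weaklyDecreasing (y≤x ∷ l) = T-∧⁺ (≤⇒≤ᵇ y≤x) (Linked⇒weaklyDecreasing l)

isPartitionOf⇒ : ∀ {n xs} → T (isPartitionOf n xs) → sum xs ≡ n × Positive xs × Descending xs
isPartitionOf⇒ {n} {xs} t =
  let s , t′ = T-∧⁻ t ; p , w = T-∧⁻ t′ in
  ≡ᵇ⇒≡ (sum xs) n s
  , All.map (≤ᵇ⇒≤ 1 _) (All.all⁺ (1 ≤ᵇ_) xs p)
  , Linked⇒AllPairs ≥-trans (weaklyDecreasing⇒Linked xs w)

isPartitionOf⇐ : ∀ {n xs} → sum xs ≡ n → Positive xs → Descending xs → T (isPartitionOf n xs)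
isPartitionOf⇐ {n} {xs} s p d =
  T-∧⁺ (≡⇒≡ᵇ (sum xs) n s)
    (T-∧⁺ (All.all⁻ (1 ≤ᵇ_) (All.map ≤⇒≤ᵇ p)) (Linked⇒weaklyDecreasing (AllPairs⇒Linked d)))

Descending⇒All≤head : ∀ {b xs} → Descending xs → part xs 1 ≤ b → All (_≤ b) xs
Descending⇒All≤head [] _ = []
Descending⇒All≤head (xs≤x ∷ _) x≤b = x≤b ∷ All.map (λ y≤x → ≤-trans y≤x x≤b) xs≤x

Descending⇒last≤ : ∀ {zs y} → Descending (zs ∷ʳ y) → All (y ≤_) zs
Descending⇒last≤ {[]} _ = []
Descending⇒last≤ {z ∷ zs} (z≥ ∷ desc) = proj₂ (All.∷ʳ⁻ z≥) ∷ Descending⇒last≤ desc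

Descending-++⁻ˡ : ∀ xs {ys} → Descending (xs ++ ys) → Descending xs
Descending-++⁻ˡ [] _ = []
Descending-++⁻ˡ (x ∷ xs) (x≥ ∷ desc) = All.++⁻ˡ xs x≥ ∷ Descending-++⁻ˡ xs desc

part-≤ : ∀ {b xs} → All (_≤ b) xs → ∀ i → part xs i ≤ b
part-≤ [] _ = z≤n
part-≤ (_ ∷ _) zero = z≤n
part-≤ (x≤b ∷ _) (suc zero) = x≤b
part-≤ (_ ∷ xs≤b) (suc (suc i)) = part-≤ xs≤b (suc i)

part-drop : ∀ d xs i → part (drop d xs) (suc i) ≡ part xs (suc (d + i))
part-drop zero xs i = refl
part-drop (suc d) [] i = refl
part-drop (suc d) (x ∷ xs) i = part-drop d xs i

part-antitone : ∀ {xs} → Descending xs → ∀ {i k} → i ≤ k → part xs (suc k) ≤ part xs (suc i)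
part-antitone [] _ = z≤n
part-antitone (xs≤x ∷ _) {zero} {k} _ = part-≤ (≤-refl ∷ xs≤x) (suc k)
part-antitone (_ ∷ d) {suc i} {suc k} (s≤s i≤k) = part-antitone d i≤k

0<part⇒<length : ∀ xs {i} → 0 < part xs (suc i) → i < length xs
0<part⇒<length (x ∷ xs) {zero} _ = z<s
0<part⇒<length (x ∷ xs) {suc i} 0<p = s≤s (0<part⇒<length xs 0<p)

≡part₁∷drop1 : ∀ xs → 0 < length xs → xs ≡ part xs 1 ∷ drop 1 xs
≡part₁∷drop1 (x ∷ xs) _ = refl

≡part₁∷part₂∷drop2 : ∀ xs → 0 < part xs 2 → xs ≡ part xs 1 ∷ part xs 2 ∷ drop 2 xs
≡part₁∷part₂∷drop2 (x ∷ y ∷ xs) _ = refl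

part-applyUpTo-++ : ∀ (f : ℕ → ℕ) {n} ys {i} → i < n → part (applyUpTo f n ++ ys) (suc i) ≡ f i
part-applyUpTo-++ f {suc n} ys {zero} _ = refl
part-applyUpTo-++ f {suc n} ys {suc i} (s≤s i<n) = part-applyUpTo-++ (f ∘ suc) ys i<n

part-applyUpTo-++-≤ : ∀ (f : ℕ → ℕ) n {b ys i} → n ≤ i → All (_≤ b) ys →
                      part (applyUpTo f n ++ ys) (suc i) ≤ b
part-applyUpTo-++-≤ f zero {i = i} _ ys≤b = part-≤ ys≤b (suc i)
part-applyUpTo-++-≤ f (suc n) {i = suc i} (s≤s n≤i) ys≤b = part-applyUpTo-++-≤ (f ∘ suc) n n≤i ys≤b

drop-applyUpTo-++ : ∀ (f : ℕ → ℕ) n ys → drop n (applyUpTo f n ++ ys) ≡ ys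
drop-applyUpTo-++ f zero ys = refl
drop-applyUpTo-++ f (suc n) ys = drop-applyUpTo-++ (f ∘ suc) n ys

applyUpTo-part : ∀ xs → applyUpTo (λ i → part xs (suc i)) (length xs) ≡ xs
applyUpTo-part [] = refl
applyUpTo-part (x ∷ xs) = cong (x ∷_) (applyUpTo-part xs)

applyUpTo-++-drop : ∀ (f : ℕ → ℕ) {n} xs → n ≤ length xs →
                    (∀ {i} → i < n → f i ≡ part xs (suc i)) → applyUpTo f n ++ drop n xs ≡ xs
applyUpTo-++-drop f {zero} xs _ _ = refl
applyUpTo-++-drop f {suc n} (x ∷ xs) (s≤s n≤l) f≡ =
  cong₂ _∷_ (f≡ z<s) (applyUpTo-++-drop (f ∘ suc) xs n≤l (f≡ ∘ s<s))

applyUpTo-cong : ∀ {f g : ℕ → ℕ} → (∀ i → f i ≡ g i) → ∀ n → applyUpTo f n ≡ applyUpTo g n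
applyUpTo-cong {f} {g} f≗g n = begin
  applyUpTo f n    ≡⟨ sym (map-upTo f n) ⟩
  map f (upTo n)   ≡⟨ map-cong f≗g (upTo n) ⟩
  map g (upTo n)   ≡⟨ map-upTo g n ⟩
  applyUpTo g n    ∎

dropLast : List ℕ → List ℕ
dropLast [] = []
dropLast (x ∷ []) = []
dropLast (x ∷ y ∷ ys) = x ∷ dropLast (y ∷ ys)

dropLast-∷ʳ : ∀ xs x → dropLast (xs ∷ʳ x) ≡ xs
dropLast-∷ʳ [] x = refl
dropLast-∷ʳ (y ∷ []) x = refl
dropLast-∷ʳ (y ∷ z ∷ zs) x = cong (y ∷_) (dropLast-∷ʳ (z ∷ zs) x)

length-∷ʳ : ∀ (xs : List ℕ) x → length (xs ∷ʳ x) ≡ suc (length xs)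
length-∷ʳ xs x = trans (length-++ xs) (+-comm (length xs) 1)

≤foldr-⊓⇔All : ∀ {k} x xs → k ≤ foldr _⊓_ x xs ⇔ All (k ≤_) (x ∷ xs)
≤foldr-⊓⇔All x [] = mk⇔ (_∷ []) (λ { (k≤x ∷ []) → k≤x })
≤foldr-⊓⇔All x (y ∷ ys) = mk⇔
  (λ k≤min → insert (m≤n⊓o⇒m≤n y _ k≤min) (to (≤foldr-⊓⇔All x ys) (m≤n⊓o⇒m≤o y _ k≤min)))
  (λ { (k≤x ∷ k≤y ∷ k≤ys) → ⊓-glb k≤y (from (≤foldr-⊓⇔All x ys) (k≤x ∷ k≤ys)) })
  where
    insert : ∀ {k} → k ≤ y → All (k ≤_) (x ∷ ys) → All (k ≤_) (x ∷ y ∷ ys)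
    insert k≤y (k≤x ∷ k≤ys) = k≤x ∷ k≤y ∷ k≤ys

smallestGeq⇔All : ∀ k xs → T (smallestGeq xs k) ⇔ All (k ≤_) xs
smallestGeq⇔All k [] = mk⇔ (λ _ → []) (λ _ → _)
smallestGeq⇔All k (x ∷ xs) = mk⇔ (to (≤foldr-⊓⇔All x xs) ∘ ≤ᵇ⇒≤ k _) (≤⇒≤ᵇ ∘ from (≤foldr-⊓⇔All x xs))

smallestEq-descending : ∀ x ys {y} k → Descending (x ∷ ys ∷ʳ y) →
                        T (smallestEq (x ∷ ys ∷ʳ y) k) ⇔ y ≡ k
smallestEq-descending x ys {y} k desc = mk⇔
  (λ t → trans (sym min≡y) (≡ᵇ⇒≡ _ k t)) (λ y≡k → ≡⇒≡ᵇ _ k (trans min≡y y≡k))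
  where
    min≡y : foldr _⊓_ x (ys ∷ʳ y) ≡ y
    min≡y = ≤-antisym
      (proj₂ (All.∷ʳ⁻ {xs = x ∷ ys} (to (≤foldr-⊓⇔All x (ys ∷ʳ y)) ≤-refl)))
      (from (≤foldr-⊓⇔All x (ys ∷ʳ y)) (All.∷ʳ⁺ (Descending⇒last≤ {x ∷ ys} desc) ≤-refl))

smallestEq⇒∷ʳ : ∀ {k} x y X → 0 < length X → Descending (x ∷ y ∷ X) →
                T (smallestEq (x ∷ y ∷ X) k) → X ≡ dropLast X ∷ʳ k
smallestEq⇒∷ʳ {k} x y X 0<ℓ desc smallest with initLast X
... | ys ∷ʳ′ z =
  cong₂ _∷ʳ_ (sym (dropLast-∷ʳ ys z)) (to (smallestEq-descending x (y ∷ ys) k desc) smallest)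

-- Conjugate parts

conjPart-accept : ∀ {r x} xs → r ≤ x → conjPart (x ∷ xs) r ≡ suc (conjPart xs r)
conjPart-accept {r} xs r≤x = cong length (filter-accept (r ≤?_) r≤x)

conjPart-reject : ∀ {r x} xs → x < r → conjPart (x ∷ xs) r ≡ conjPart xs r
conjPart-reject {r} xs x<r = cong length (filter-reject (r ≤?_) (<⇒≱ x<r))

conjPart-++ : ∀ xs ys r → conjPart (xs ++ ys) r ≡ conjPart xs r + conjPart ys r
conjPart-++ xs ys r = trans (cong length (filter-++ (r ≤?_) xs ys)) (length-++ (filter (r ≤?_) xs))

conjPart-all< : ∀ {r xs} → All (_< r) xs → conjPart xs r ≡ 0
conjPart-all< {r} xs<r = cong length (filter-none (r ≤?_) (All.map <⇒≱ xs<r))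

conjPart-1 : ∀ {xs} → Positive xs → conjPart xs 1 ≡ length xs
conjPart-1 pos = cong length (filter-all (1 ≤?_) pos)

<conjPart⇔<part : ∀ {xs} → Descending xs → ∀ k r → k < conjPart xs (suc r) ⇔ r < part xs (suc k)
<conjPart⇔<part [] k r = mk⇔ (λ ()) (λ ())
<conjPart⇔<part {x ∷ xs} (xs≤x ∷ d) k r with suc r ≤? x
... | yes r<x = shift k
  where
    shift : ∀ k → k < conjPart (x ∷ xs) (suc r) ⇔ r < part (x ∷ xs) (suc k)
    shift zero = mk⇔ (λ _ → r<x) (λ _ → subst (0 <_) (sym (conjPart-accept xs r<x)) z<s)
    shift (suc k) = mk⇔
      (to (<conjPart⇔<part d k r) ∘ s<s⁻¹ ∘ subst (suc k <_) (conjPart-accept xs r<x))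
      (subst (suc k <_) (sym (conjPart-accept xs r<x)) ∘ s<s ∘ from (<conjPart⇔<part d k r))
... | no r≮x = mk⇔ (λ k<0 → contradiction (subst (k <_) none k<0) n≮0)
                   (λ r<p → contradiction (<-≤-trans r<p (part-≤ (≤-refl ∷ xs≤x) (suc k))) r≮x)
  where
    none : conjPart (x ∷ xs) (suc r) ≡ 0
    none = conjPart-all< (All.map (λ y≤x → s≤s (≤-trans y≤x (≤-pred (≰⇒> r≮x)))) (≤-refl ∷ xs≤x))

conjPart-antitone : ∀ {xs} → Descending xs → ∀ {r r′} → r ≤ r′ →
                    conjPart xs (suc r′) ≤ conjPart xs (suc r)
conjPart-antitone d {r} {r′} r≤r′ =
  ≤-via-< (from (<conjPart⇔<part d _ r) ∘ ≤-<-trans r≤r′ ∘ to (<conjPart⇔<part d _ r′))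

conjPart-applyUpTo : ∀ (f : ℕ → ℕ) n r {c} → c ≤ n → (∀ {i} → i < n → r ≤ f i ⇔ i < c) →
                     conjPart (applyUpTo f n) r ≡ c
conjPart-applyUpTo f zero r {zero} _ _ = refl
conjPart-applyUpTo f (suc n) r {zero} _ spec =
  trans (conjPart-reject _ (≰⇒> (λ r≤f0 → n≮0 (to (spec z<s) r≤f0))))
        (conjPart-applyUpTo (f ∘ suc) n r z≤n
          (λ i<n → mk⇔ (λ r≤f → contradiction (to (spec (s<s i<n)) r≤f) n≮0) (λ ())))
conjPart-applyUpTo f (suc n) r {suc c} (s≤s c≤n) spec =
  trans (conjPart-accept _ (from (spec z<s) z<s))
        (cong suc (conjPart-applyUpTo (f ∘ suc) n r c≤n
          (λ i<n → mk⇔ (s<s⁻¹ ∘ to (spec (s<s i<n))) (from (spec (s<s i<n)) ∘ s<s))))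

sum-applyUpTo-+ : ∀ (f g : ℕ → ℕ) n →
  sum (applyUpTo (λ i → f i + g i) n) ≡ sum (applyUpTo f n) + sum (applyUpTo g n)
sum-applyUpTo-+ f g zero = refl
sum-applyUpTo-+ f g (suc n) =
  trans (cong (f 0 + g 0 +_) (sum-applyUpTo-+ (f ∘ suc) (g ∘ suc) n)) (interchange (f 0) (g 0) _ _)

sum-applyUpTo-const : ∀ c n → sum (applyUpTo (λ _ → c) n) ≡ n * c
sum-applyUpTo-const c zero = refl
sum-applyUpTo-const c (suc n) = cong (c +_) (sum-applyUpTo-const c n)

sum-applyUpTo-conjPart-singleton : ∀ a {n} → a ≤ n → sum (applyUpTo (λ i → conjPart (a ∷ []) (suc i)) n) ≡ a
sum-applyUpTo-conjPart-singleton zero {zero} _ = refl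
sum-applyUpTo-conjPart-singleton zero {suc n} _ = sum-applyUpTo-conjPart-singleton zero {n} z≤n
sum-applyUpTo-conjPart-singleton (suc a) {suc n} (s≤s a≤n) = cong suc (begin
  sum (applyUpTo (λ i → conjPart (suc a ∷ []) (suc (suc i))) n)
    ≡⟨ cong sum (applyUpTo-cong shift n) ⟩
  sum (applyUpTo (λ i → conjPart (a ∷ []) (suc i)) n)
    ≡⟨ sum-applyUpTo-conjPart-singleton a a≤n ⟩
  a ∎)
  where
    shift : ∀ i → conjPart (suc a ∷ []) (suc (suc i)) ≡ conjPart (a ∷ []) (suc i)
    shift i with suc i ≤? a
    ... | yes i<a = trans (conjPart-accept [] (s≤s i<a)) (sym (conjPart-accept [] i<a))
    ... | no i≮a = trans (conjPart-reject [] (s<s (≰⇒> i≮a))) (sym (conjPart-reject [] (≰⇒> i≮a)))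

sum-applyUpTo-conjPart : ∀ {n} α → All (_≤ n) α → sum (applyUpTo (λ i → conjPart α (suc i)) n) ≡ sum α
sum-applyUpTo-conjPart {n} [] _ = trans (sum-applyUpTo-const 0 n) (*-zeroʳ n)
sum-applyUpTo-conjPart {n} (a ∷ α) (a≤n ∷ α≤n) = begin
  sum (applyUpTo (λ i → conjPart (a ∷ α) (suc i)) n)
    ≡⟨ cong sum (applyUpTo-cong (λ i → conjPart-++ (a ∷ []) α (suc i)) n) ⟩
  sum (applyUpTo (λ i → conjPart (a ∷ []) (suc i) + conjPart α (suc i)) n)
    ≡⟨ sum-applyUpTo-+ _ _ n ⟩
  sum (applyUpTo (λ i → conjPart (a ∷ []) (suc i)) n) + sum (applyUpTo (λ i → conjPart α (suc i)) n)
    ≡⟨ cong₂ _+_ (sum-applyUpTo-conjPart-singleton a a≤n) (sum-applyUpTo-conjPart α α≤n) ⟩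
  a + sum α ∎

-- Durfee squares and Durfee symbols

durfeeAux-< : ∀ k xs {i} → i < durfeeAux k xs → k + i < part xs (suc i)
durfeeAux-< k (x ∷ xs) {i} i<d with suc k ≤ᵇ x | ≤ᵇ-reflects-≤ (suc k) x
durfeeAux-< k (x ∷ xs) {zero} _ | true | ofʸ k<x = subst (_< x) (sym (+-identityʳ k)) k<x
durfeeAux-< k (x ∷ xs) {suc i} (s≤s i<d) | true | ofʸ _ =
  subst (_< part xs (suc i)) (sym (+-suc k i)) (durfeeAux-< (suc k) xs i<d)

durfeeAux-≮ : ∀ k xs → ¬ (k + durfeeAux k xs < part xs (suc (durfeeAux k xs)))
durfeeAux-≮ k (x ∷ xs) with suc k ≤ᵇ x | ≤ᵇ-reflects-≤ (suc k) x
... | true | ofʸ _ = durfeeAux-≮ (suc k) xs ∘ subst (_< part xs (suc (durfeeAux (suc k) xs))) (+-suc k _)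
... | false | ofⁿ k≮x = k≮x ∘ subst (_< x) (+-identityʳ k)

durfeeAux≤length : ∀ k xs → durfeeAux k xs ≤ length xs
durfeeAux≤length k [] = z≤n
durfeeAux≤length k (x ∷ xs) with suc k ≤ᵇ x
... | true = s≤s (durfeeAux≤length (suc k) xs)
... | false = z≤n

durfeeAux-unique : ∀ k xs d → (∀ {i} → i < d → k + i < part xs (suc i)) →
                   ¬ (k + d < part xs (suc d)) → durfeeAux k xs ≡ d
durfeeAux-unique k [] zero _ _ = refl
durfeeAux-unique k [] (suc d) below _ with () ← below z<s
durfeeAux-unique k (x ∷ xs) d below notAt with suc k ≤ᵇ x | ≤ᵇ-reflects-≤ (suc k) x
durfeeAux-unique k (x ∷ xs) zero below notAt | true | ofʸ k<x =
  contradiction (subst (_< x) (sym (+-identityʳ k)) k<x) notAt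
durfeeAux-unique k (x ∷ xs) (suc d) below notAt | true | ofʸ _ =
  cong suc (durfeeAux-unique (suc k) xs d
    (λ {i} i<d → subst (_< part xs (suc i)) (+-suc k i) (below (s<s i<d)))
    (notAt ∘ subst (_< part xs (suc d)) (sym (+-suc k d))))
durfeeAux-unique k (x ∷ xs) zero below notAt | false | ofⁿ _ = refl
durfeeAux-unique k (x ∷ xs) (suc d) below notAt | false | ofⁿ k≮x =
  contradiction (subst (_< x) (+-identityʳ k) (below z<s)) k≮x

-- α is given by its column lengths, as durfeeα computes it, so row i < j has length j + α′ᵢ₊₁.
fromDurfeeSymbol : ℕ → List ℕ → List ℕ → List ℕ
fromDurfeeSymbol j α β = applyUpTo (λ i → j + conjPart α (suc i)) j ++ β

record IsDurfeeSymbol (j : ℕ) (α β : List ℕ) : Set where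
  field
    α-descending : Descending α
    α-positive   : Positive α
    α-≤          : All (_≤ j) α
    β-descending : Descending β
    β-positive   : Positive β
    β-≤          : All (_≤ j) β

module DurfeeSymbolOf {xs : List ℕ} (descending : Descending xs) where

  j : ℕ
  j = durfee xs

  arm : ℕ → ℕ
  arm t = conjPart xs (j + suc t)

  <arm⇔ : ∀ k t → k < arm t ⇔ j + t < part xs (suc k)
  <arm⇔ k t = subst (λ r → k < conjPart xs r ⇔ j + t < part xs (suc k)) (sym (+-suc j t))
                    (<conjPart⇔<part descending k (j + t))

  durfee≤part : ∀ {i} → i < j → j ≤ part xs (suc i)
  durfee≤part {i} i<j with durfee xs | durfeeAux-< 0 xs
  ... | suc m | below = ≤-trans (below ≤-refl) (part-antitone descending (≤-pred i<j))

  part≤durfee : part xs (suc j) ≤ j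
  part≤durfee = ≮⇒≥ (durfeeAux-≮ 0 xs)

  durfeeα≡applyUpTo : durfeeα xs ≡ applyUpTo arm (part xs 1 ∸ j)
  durfeeα≡applyUpTo = map-upTo arm (part xs 1 ∸ j)

  conjPart-durfeeα : ∀ i → conjPart (durfeeα xs) (suc i) ≡ part xs (suc i) ∸ j
  conjPart-durfeeα i =
    trans (cong (λ α → conjPart α (suc i)) durfeeα≡applyUpTo)
          (conjPart-applyUpTo arm _ (suc i) (∸-monoˡ-≤ j (part-antitone descending z≤n))
            (λ {t} _ → +<⇔<∸ j ⇔-∘ <arm⇔ i t))

  fixedRow⇒durfee : ∀ {i} → part xs (suc i) ≡ i → i ≡ j
  fixedRow⇒durfee {i} p≡i with <-cmp i j
  ... | tri< i<j _ _ = contradiction (subst (j ≤_) p≡i (durfee≤part i<j)) (<⇒≱ i<j)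
  ... | tri≈ _ i≡j _ = i≡j
  ... | tri> _ _ j<i = contradiction
    (subst (_≤ j) p≡i (≤-trans (part-antitone descending (<⇒≤ j<i)) part≤durfee)) (<⇒≱ j<i)

  arm-antitone : ∀ {t u} → t ≤ u → arm u ≤ arm t
  arm-antitone {t} {u} t≤u =
    ≤-via-< (from (<arm⇔ _ t) ∘ ≤-<-trans (+-monoʳ-≤ j t≤u) ∘ to (<arm⇔ _ u))

  arm≤durfee : ∀ t → arm t ≤ j
  arm≤durfee t = ≤-via-< λ {k} k<arm → ≰⇒> λ j≤k →
    <⇒≱ (to (<arm⇔ k t) k<arm)
        (≤-trans (part-antitone descending j≤k) (≤-trans part≤durfee (m≤m+n j t)))

  isDurfeeSymbol : Positive xs → IsDurfeeSymbol j (durfeeα xs) (durfeeβ xs)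
  isDurfeeSymbol positive = record
    { α-descending = subst Descending (sym durfeeα≡applyUpTo)
        (AllPairs.applyUpTo⁺₁ arm _ (λ t<u _ → arm-antitone (<⇒≤ t<u)))
    ; α-positive = subst Positive (sym durfeeα≡applyUpTo)
        (All.applyUpTo⁺₁ arm _ (λ {t} t<L → from (<arm⇔ 0 t) (from (+<⇔<∸ j) t<L)))
    ; α-≤ = subst (All (_≤ j)) (sym durfeeα≡applyUpTo) (All.applyUpTo⁺₂ arm _ arm≤durfee)
    ; β-descending = AllPairs.drop⁺ j descending
    ; β-positive = All.drop⁺ j positive
    ; β-≤ = Descending⇒All≤head (AllPairs.drop⁺ j descending)
              (subst (_≤ j) (sym (trans (part-drop j xs 0) (cong (part xs ∘ suc) (+-identityʳ j))))
                     part≤durfee)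
    }

  fromDurfeeSymbol-durfee : fromDurfeeSymbol j (durfeeα xs) (durfeeβ xs) ≡ xs
  fromDurfeeSymbol-durfee = applyUpTo-++-drop _ xs (durfeeAux≤length 0 xs) λ {i} i<j →
    trans (cong (j +_) (conjPart-durfeeα i)) (m+[n∸m]≡n (durfee≤part i<j))

module FromDurfeeSymbol {j α β} (0<j : 0 < j) (symbol : IsDurfeeSymbol j α β) where
  open IsDurfeeSymbol symbol

  row : ℕ → ℕ
  row i = j + conjPart α (suc i)

  xs : List ℕ
  xs = fromDurfeeSymbol j α β

  durfee-fromDurfeeSymbol : durfee xs ≡ j
  durfee-fromDurfeeSymbol = durfeeAux-unique 0 xs j
    (λ i<j → subst (_ <_) (sym (part-applyUpTo-++ row β i<j)) (<-≤-trans i<j (m≤m+n j _)))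
    (λ j<part → <⇒≱ j<part (part-applyUpTo-++-≤ row j ≤-refl β-≤))

  durfeeβ-fromDurfeeSymbol : durfeeβ xs ≡ β
  durfeeβ-fromDurfeeSymbol =
    trans (cong (λ d → drop d xs) durfee-fromDurfeeSymbol) (drop-applyUpTo-++ row j β)

  conjPart-fromDurfeeSymbol : ∀ t → conjPart xs (j + suc t) ≡ part α (suc t)
  conjPart-fromDurfeeSymbol t = begin
    conjPart xs (j + suc t)
      ≡⟨ conjPart-++ (applyUpTo row j) β (j + suc t) ⟩
    conjPart (applyUpTo row j) (j + suc t) + conjPart β (j + suc t)
      ≡⟨ cong₂ _+_ arms (conjPart-all< (All.map (λ b≤j → ≤-<-trans b≤j (m<m+n j z<s)) β-≤)) ⟩
    part α (suc t) + 0
      ≡⟨ +-identityʳ _ ⟩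
    part α (suc t) ∎
    where
      arms : conjPart (applyUpTo row j) (j + suc t) ≡ part α (suc t)
      arms = conjPart-applyUpTo row j (j + suc t) (part-≤ α-≤ (suc t)) λ {i} _ →
        <conjPart⇔<part α-descending t i ⇔-∘ mk⇔ (+-cancelˡ-≤ j _ _) (+-monoʳ-≤ j)

  part₁-fromDurfeeSymbol : part xs 1 ≡ j + length α
  part₁-fromDurfeeSymbol = trans (part-applyUpTo-++ row β 0<j) (cong (j +_) (conjPart-1 α-positive))

  length-fromDurfeeSymbol : length xs ≡ j + length β
  length-fromDurfeeSymbol =
    trans (length-++ (applyUpTo row j)) (cong (_+ length β) (length-applyUpTo row j))

  durfeeα-fromDurfeeSymbol : durfeeα xs ≡ α
  durfeeα-fromDurfeeSymbol = begin
    map (λ t → conjPart xs (durfee xs + suc t)) (upTo (part xs 1 ∸ durfee xs))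
      ≡⟨ cong (λ d → map (λ t → conjPart xs (d + suc t)) (upTo (part xs 1 ∸ d)))
              durfee-fromDurfeeSymbol ⟩
    map (λ t → conjPart xs (j + suc t)) (upTo (part xs 1 ∸ j))
      ≡⟨ cong (λ L → map (λ t → conjPart xs (j + suc t)) (upTo L)) armLength ⟩
    map (λ t → conjPart xs (j + suc t)) (upTo (length α))
      ≡⟨ map-cong conjPart-fromDurfeeSymbol (upTo (length α)) ⟩
    map (λ t → part α (suc t)) (upTo (length α))
      ≡⟨ map-upTo _ (length α) ⟩
    applyUpTo (λ t → part α (suc t)) (length α)
      ≡⟨ applyUpTo-part α ⟩
    α ∎
    where
      armLength : part xs 1 ∸ j ≡ length α
      armLength = trans (cong (_∸ j) part₁-fromDurfeeSymbol) (m+n∸m≡n j (length α))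

  descending : Descending xs
  descending = AllPairs.++⁺
    (AllPairs.applyUpTo⁺₁ row j (λ i<k _ → +-monoʳ-≤ j (conjPart-antitone α-descending (<⇒≤ i<k))))
    β-descending
    (All.applyUpTo⁺₂ row j (λ i → All.map (λ b≤j → ≤-trans b≤j (m≤m+n j _)) β-≤))

  positive : Positive xs
  positive = All.++⁺ (All.applyUpTo⁺₂ row j (λ i → ≤-trans 0<j (m≤m+n j _))) β-positive

  sum-fromDurfeeSymbol : sum xs ≡ j * j + sum α + sum β
  sum-fromDurfeeSymbol = begin
    sum (applyUpTo row j ++ β)
      ≡⟨ sum-++ (applyUpTo row j) β ⟩
    sum (applyUpTo row j) + sum β
      ≡⟨ cong (_+ sum β) (sum-applyUpTo-+ (λ _ → j) (λ i → conjPart α (suc i)) j) ⟩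
    sum (applyUpTo (λ _ → j) j) + sum (applyUpTo (λ i → conjPart α (suc i)) j) + sum β
      ≡⟨ cong (λ s → s + sum (applyUpTo (λ i → conjPart α (suc i)) j) + sum β)
              (sum-applyUpTo-const j j) ⟩
    j * j + sum (applyUpTo (λ i → conjPart α (suc i)) j) + sum β
      ≡⟨ cong (λ s → j * j + s + sum β) (sum-applyUpTo-conjPart α α-≤) ⟩
    j * j + sum α + sum β ∎

0∈rankSet⇔ : ∀ {xs} → Descending xs → 0 < durfee xs →
             T (inRankSet (ℤ.+ 0) xs) ⇔ part xs (suc (durfee xs)) ≡ durfee xs
0∈rankSet⇔ {xs} desc 0<j = mk⇔ fixedRow (λ p≡j → from T-∨ (inj₁ (Any.any⁺ isFixed
  (lose (∈-upTo⁺ (0<part⇒<length xs (subst (0 <_) (sym p≡j) 0<j)))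
        (fromWitness (sym (ℤ.i≡j⇒i-j≡0 (cong ℤ.+_ (sym p≡j)))))))))
  where
    open DurfeeSymbolOf desc
    isFixed : ℕ → Bool
    isFixed i = ⌊ ℤ.+ 0 ℤ.≟ (ℤ.+ i) ℤ.- (ℤ.+ part xs (suc i)) ⌋
    fixedRow : T (inRankSet (ℤ.+ 0) xs) → part xs (suc j) ≡ j
    fixedRow t with to T-∨ t
    ... | inj₂ ℓ≤0 =
      contradiction (ℤ.drop‿+≤+ (toWitness ℓ≤0)) (<⇒≱ (<-≤-trans 0<j (durfeeAux≤length 0 xs)))
    ... | inj₁ some with satisfied (Any.any⁻ isFixed (upTo (length xs)) some)
    ...   | i , fixed = subst (λ k → part xs (suc k) ≡ k) (fixedRow⇒durfee p≡i) p≡i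
      where
        p≡i : part xs (suc i) ≡ i
        p≡i = sym (ℤ.+-injective (ℤ.i-j≡0⇒i≡j (ℤ.+ i) (ℤ.+ part xs (suc i)) (sym (toWitness fixed))))

-- Q̄₄(0,n)

qbar4Partition : ℕ → List ℕ → List ℕ → List ℕ
qbar4Partition j A B = fromDurfeeSymbol j (j ∷ j ∷ A) (j ∷ j ∷ B ∷ʳ 2)

record Qbar4Symbol (j : ℕ) (A B : List ℕ) : Set where
  field
    2≤j          : 2 ≤ j
    A-descending : Descending A
    2≤A          : All (2 ≤_) A
    A≤j          : All (_≤ j) A
    B-descending : Descending B
    2≤B          : All (2 ≤_) B
    B≤j          : All (_≤ j) B
    ℓA≤ℓB        : length A ≤ length B

qbar4A : List ℕ → List ℕ
qbar4A xs = drop 2 (durfeeα xs)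

qbar4B : List ℕ → List ℕ
qbar4B xs = dropLast (drop 2 (durfeeβ xs))

module Qbar4SymbolOf
  {xs} (descending : Descending xs) (positive : Positive xs) (0<j : 0 < durfee xs)
  (row≡j : part xs (suc (durfee xs)) ≡ durfee xs)
  (ℓα<ℓβ : length (durfeeα xs) < length (durfeeβ xs))
  (α₁≡j : part (durfeeα xs) 1 ≡ durfee xs) (α₂≡j : part (durfeeα xs) 2 ≡ durfee xs)
  (2≤α : All (2 ≤_) (durfeeα xs))
  (β₁≡β₂ : part (durfeeβ xs) 1 ≡ part (durfeeβ xs) 2)
  (β-smallest : T (smallestEq (durfeeβ xs) 2))
  where

  open DurfeeSymbolOf descending
  open IsDurfeeSymbol (isDurfeeSymbol positive)

  A X B : List ℕ
  A = qbar4A xs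
  X = drop 2 (durfeeβ xs)
  B = qbar4B xs

  α≡ : durfeeα xs ≡ j ∷ j ∷ A
  α≡ = trans (≡part₁∷part₂∷drop2 (durfeeα xs) (subst (0 <_) (sym α₂≡j) 0<j))
             (cong₂ (λ a b → a ∷ b ∷ A) α₁≡j α₂≡j)

  β₁≡j : part (durfeeβ xs) 1 ≡ j
  β₁≡j = trans (part-drop j xs 0) (trans (cong (part xs ∘ suc) (+-identityʳ j)) row≡j)

  β≡j∷j∷X : durfeeβ xs ≡ j ∷ j ∷ X
  β≡j∷j∷X = trans (≡part₁∷part₂∷drop2 (durfeeβ xs) (subst (0 <_) (trans (sym β₁≡j) β₁≡β₂) 0<j))
                  (cong₂ (λ a b → a ∷ b ∷ X) β₁≡j (trans (sym β₁≡β₂) β₁≡j))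

  ℓA<ℓX : length A < length X
  ℓA<ℓX = s≤s⁻¹ (s≤s⁻¹ (subst₂ (λ α β → length α < length β) α≡ β≡j∷j∷X ℓα<ℓβ))

  X≡B∷ʳ2 : X ≡ B ∷ʳ 2
  X≡B∷ʳ2 = smallestEq⇒∷ʳ j j X (≤-<-trans z≤n ℓA<ℓX)
    (subst Descending β≡j∷j∷X β-descending) (subst (λ β → T (smallestEq β 2)) β≡j∷j∷X β-smallest)

  β≡ : durfeeβ xs ≡ j ∷ j ∷ B ∷ʳ 2
  β≡ = trans β≡j∷j∷X (cong (λ Y → j ∷ j ∷ Y) X≡B∷ʳ2)

  symbol : Qbar4Symbol j A B
  symbol = record
    { 2≤j = head2≤ (subst (All (2 ≤_)) α≡ 2≤α)
    ; A-descending = AllPairs.drop⁺ 2 α-descending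
    ; 2≤A = All.drop⁺ 2 2≤α
    ; A≤j = All.drop⁺ 2 α-≤
    ; B-descending = Descending-++⁻ˡ B (AllPairs.drop⁺ 2 β′-descending)
    ; 2≤B = All.drop⁺ 2 (Descending⇒last≤ {j ∷ j ∷ B} β′-descending)
    ; B≤j = All.++⁻ˡ B (All.drop⁺ 2 (subst (All (_≤ j)) β≡ β-≤))
    ; ℓA≤ℓB = m<1+n⇒m≤n (subst (length A <_) (trans (cong length X≡B∷ʳ2) (length-∷ʳ B 2)) ℓA<ℓX)
    }
    where
      head2≤ : ∀ {ys} → All (2 ≤_) (j ∷ ys) → 2 ≤ j
      head2≤ (2≤j ∷ _) = 2≤j
      β′-descending : Descending (j ∷ j ∷ B ∷ʳ 2)
      β′-descending = subst Descending β≡ β-descending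

  qbar4Partition-symbol : qbar4Partition j A B ≡ xs
  qbar4Partition-symbol = trans (cong₂ (fromDurfeeSymbol j) (sym α≡) (sym β≡)) fromDurfeeSymbol-durfee

inQbar4⇒ : ∀ {n xs} → T (inQbar4 n xs) →
           sum xs ≡ n × Qbar4Symbol (durfee xs) (qbar4A xs) (qbar4B xs)
                      × qbar4Partition (durfee xs) (qbar4A xs) (qbar4B xs) ≡ xs
inQbar4⇒ {n} {xs} t =
  let q0 , t₁ = T-∧⁻ t
      isPart , rank = T-∧⁻ q0
      sum≡n , positive , descending = isPartitionOf⇒ isPart
      1≤j , t₂ = T-∧⁻ t₁
      ℓα<ℓβ , t₃ = T-∧⁻ t₂
      α₁≡j , t₄ = T-∧⁻ t₃
      α₂≡j , t₅ = T-∧⁻ t₄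
      2≤α , t₆ = T-∧⁻ t₅
      β₁≡β₂ , β-smallest = T-∧⁻ t₆
      0<j = ≤ᵇ⇒≤ 1 _ 1≤j
      open Qbar4SymbolOf {xs} descending positive 0<j (to (0∈rankSet⇔ descending 0<j) rank)
             (≤ᵇ⇒≤ _ _ ℓα<ℓβ) (≡ᵇ⇒≡ _ _ α₁≡j) (≡ᵇ⇒≡ _ _ α₂≡j) (to (smallestGeq⇔All 2 _) 2≤α)
             (≡ᵇ⇒≡ _ _ β₁≡β₂) β-smallest
  in sum≡n , symbol , qbar4Partition-symbol

Qbar4Symbol⇒IsDurfeeSymbol : ∀ {j A B} → Qbar4Symbol j A B →
                             IsDurfeeSymbol j (j ∷ j ∷ A) (j ∷ j ∷ B ∷ʳ 2)
Qbar4Symbol⇒IsDurfeeSymbol {j} {A} {B} s = record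
  { α-descending = (≤-refl ∷ A≤j) ∷ A≤j ∷ A-descending
  ; α-positive = 0<j ∷ 0<j ∷ All.map (<-≤-trans z<s) 2≤A
  ; α-≤ = ≤-refl ∷ ≤-refl ∷ A≤j
  ; β-descending = (≤-refl ∷ B∷ʳ2≤j) ∷ B∷ʳ2≤j ∷ B∷ʳ2-descending
  ; β-positive = 0<j ∷ 0<j ∷ All.∷ʳ⁺ (All.map (<-≤-trans z<s) 2≤B) z<s
  ; β-≤ = ≤-refl ∷ ≤-refl ∷ B∷ʳ2≤j
  }
  where
    open Qbar4Symbol s
    0<j : 0 < j
    0<j = <-≤-trans z<s 2≤j
    B∷ʳ2≤j : All (_≤ j) (B ∷ʳ 2)
    B∷ʳ2≤j = All.∷ʳ⁺ B≤j 2≤j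
    B∷ʳ2-descending : Descending (B ∷ʳ 2)
    B∷ʳ2-descending = AllPairs.++⁺ B-descending ([] ∷ []) (All.map (_∷ []) 2≤B)

module Qbar4Partition {j A B} (s : Qbar4Symbol j A B) where
  open Qbar4Symbol s
  open IsDurfeeSymbol (Qbar4Symbol⇒IsDurfeeSymbol s) using (β-descending)
  open FromDurfeeSymbol (<-≤-trans z<s 2≤j) (Qbar4Symbol⇒IsDurfeeSymbol s)

  durfee-qbar4Partition : durfee xs ≡ j
  durfee-qbar4Partition = durfee-fromDurfeeSymbol

  qbar4A-qbar4Partition : qbar4A xs ≡ A
  qbar4A-qbar4Partition = cong (drop 2) durfeeα-fromDurfeeSymbol

  qbar4B-qbar4Partition : qbar4B xs ≡ B
  qbar4B-qbar4Partition = trans (cong (dropLast ∘ drop 2) durfeeβ-fromDurfeeSymbol) (dropLast-∷ʳ B 2)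

  inQbar4-qbar4Partition : T (inQbar4 (sum xs) xs)
  inQbar4-qbar4Partition =
    T-∧⁺ (T-∧⁺ (isPartitionOf⇐ refl positive descending) (from (0∈rankSet⇔ descending 0<j) row≡j))
    (T-∧⁺ (≤⇒≤ᵇ 0<j) (T-∧⁺ (≤⇒≤ᵇ ℓα<ℓβ) (T-∧⁺ (≡⇒≡ᵇ _ _ α₁≡j) (T-∧⁺ (≡⇒≡ᵇ _ _ α₂≡j)
    (T-∧⁺ (from (smallestGeq⇔All 2 _) 2≤α) (T-∧⁺ (≡⇒≡ᵇ _ _ β₁≡β₂) β-smallest))))))
    where
      α≡ : durfeeα xs ≡ j ∷ j ∷ A
      α≡ = durfeeα-fromDurfeeSymbol
      β≡ : durfeeβ xs ≡ j ∷ j ∷ B ∷ʳ 2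
      β≡ = durfeeβ-fromDurfeeSymbol
      j≡ : durfee xs ≡ j
      j≡ = durfee-fromDurfeeSymbol
      0<j : 0 < durfee xs
      0<j = subst (0 <_) (sym j≡) (<-≤-trans z<s 2≤j)
      row≡j : part xs (suc (durfee xs)) ≡ durfee xs
      row≡j = begin
        part xs (suc (durfee xs))       ≡⟨ cong (part xs ∘ suc) (sym (+-identityʳ _)) ⟩
        part xs (suc (durfee xs + 0))   ≡⟨ sym (part-drop (durfee xs) xs 0) ⟩
        part (durfeeβ xs) 1             ≡⟨ cong (λ β → part β 1) β≡ ⟩
        j                               ≡⟨ sym j≡ ⟩
        durfee xs                       ∎
      ℓα<ℓβ : length (durfeeα xs) < length (durfeeβ xs)
      ℓα<ℓβ = subst₂ (λ α β → length α < length β) (sym α≡) (sym β≡)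
                (s≤s (s≤s (subst (length A <_) (sym (length-∷ʳ B 2)) (s≤s ℓA≤ℓB))))
      α₁≡j : part (durfeeα xs) 1 ≡ durfee xs
      α₁≡j = trans (cong (λ α → part α 1) α≡) (sym j≡)
      α₂≡j : part (durfeeα xs) 2 ≡ durfee xs
      α₂≡j = trans (cong (λ α → part α 2) α≡) (sym j≡)
      2≤α : All (2 ≤_) (durfeeα xs)
      2≤α = subst (All (2 ≤_)) (sym α≡) (2≤j ∷ 2≤j ∷ 2≤A)
      β₁≡β₂ : part (durfeeβ xs) 1 ≡ part (durfeeβ xs) 2
      β₁≡β₂ = trans (cong (λ β → part β 1) β≡) (sym (cong (λ β → part β 2) β≡))
      β-smallest : T (smallestEq (durfeeβ xs) 2)
      β-smallest = subst (λ β → T (smallestEq β 2)) (sym β≡)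
        (from (smallestEq-descending j (j ∷ B) 2 β-descending) refl)

-- P₇(0,n)

p7Partition : ℕ → List ℕ → List ℕ → List ℕ
p7Partition j G D = fromDurfeeSymbol (suc j) (j ∷ G) (suc j ∷ D)

record P7Symbol (j : ℕ) (G D : List ℕ) : Set where
  field
    2≤j          : 2 ≤ j
    G-descending : Descending G
    G-positive   : Positive G
    G<j          : All (_< j) G
    D-descending : Descending D
    D-positive   : Positive D
    D≤1+j        : All (_≤ suc j) D
    D≢2          : All (_≢ 2) D
    ℓG≡ℓD        : length G ≡ length D

p7G : List ℕ → List ℕ
p7G xs = drop 1 (durfeeα xs)

p7D : List ℕ → List ℕ
p7D xs = drop 1 (durfeeβ xs)

module P7SymbolOf
  {xs} (descending : Descending xs) (positive : Positive xs) (0<j′ : 0 < durfee xs)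
  (ℓγ≡ℓδ : length (durfeeα xs) ≡ length (durfeeβ xs))
  (γ₁≡j : part (durfeeα xs) 1 ≡ durfee xs ∸ 1) (γ₂<γ₁ : part (durfeeα xs) 2 < part (durfeeα xs) 1)
  (δ₁≡j′ : part (durfeeβ xs) 1 ≡ durfee xs) (δ≢2 : All (_≢ 2) (durfeeβ xs))
  where

  open DurfeeSymbolOf descending renaming (j to j′)
  open IsDurfeeSymbol (isDurfeeSymbol positive)

  j : ℕ
  j = j′ ∸ 1

  G D : List ℕ
  G = p7G xs
  D = p7D xs

  1+j≡j′ : suc j ≡ j′
  1+j≡j′ = m+[n∸m]≡n 0<j′

  0<ℓγ : 0 < length (durfeeα xs)
  0<ℓγ = 0<part⇒<length (durfeeα xs) (≤-<-trans z≤n γ₂<γ₁)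

  γ≡ : durfeeα xs ≡ j ∷ G
  γ≡ = trans (≡part₁∷drop1 (durfeeα xs) 0<ℓγ) (cong (_∷ G) γ₁≡j)

  δ≡ : durfeeβ xs ≡ suc j ∷ D
  δ≡ = trans (≡part₁∷drop1 (durfeeβ xs) (subst (0 <_) ℓγ≡ℓδ 0<ℓγ))
             (cong (_∷ D) (trans δ₁≡j′ (sym 1+j≡j′)))

  2≤j : 2 ≤ j
  2≤j = 2≤ (≤-<-trans z≤n (subst (part (durfeeα xs) 2 <_) γ₁≡j γ₂<γ₁))
           (All.head (subst (All (_≢ 2)) δ≡ δ≢2))
    where
      2≤ : ∀ {m} → 0 < m → suc m ≢ 2 → 2 ≤ m
      2≤ {suc zero} _ 2≢2 = contradiction refl 2≢2
      2≤ {suc (suc m)} _ _ = s≤s (s≤s z≤n)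

  symbol : P7Symbol j G D
  symbol = record
    { 2≤j = 2≤j
    ; G-descending = AllPairs.drop⁺ 1 α-descending
    ; G-positive = All.drop⁺ 1 α-positive
    ; G<j = All.map (λ g≤G₁ → ≤-<-trans g≤G₁ G₁<j)
                    (Descending⇒All≤head (AllPairs.drop⁺ 1 α-descending) ≤-refl)
    ; D-descending = AllPairs.drop⁺ 1 β-descending
    ; D-positive = All.drop⁺ 1 β-positive
    ; D≤1+j = All.drop⁺ 1 (subst (λ b → All (_≤ b) (durfeeβ xs)) (sym 1+j≡j′) β-≤)
    ; D≢2 = All.drop⁺ 1 δ≢2
    ; ℓG≡ℓD = suc-injective (subst₂ (λ γ δ → length γ ≡ length δ) γ≡ δ≡ ℓγ≡ℓδ)
    }
    where
      G₁<j : part G 1 < j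
      G₁<j = subst₂ _<_ (sym (part-drop 1 (durfeeα xs) 0)) γ₁≡j γ₂<γ₁

  p7Partition-symbol : p7Partition j G D ≡ xs
  p7Partition-symbol = begin
    fromDurfeeSymbol (suc j) (j ∷ G) (suc j ∷ D)
      ≡⟨ cong₂ (fromDurfeeSymbol (suc j)) (sym γ≡) (sym δ≡) ⟩
    fromDurfeeSymbol (suc j) (durfeeα xs) (durfeeβ xs)
      ≡⟨ cong (λ d → fromDurfeeSymbol d (durfeeα xs) (durfeeβ xs)) 1+j≡j′ ⟩
    fromDurfeeSymbol j′ (durfeeα xs) (durfeeβ xs)
      ≡⟨ fromDurfeeSymbol-durfee ⟩
    xs ∎

inP7⇒ : ∀ {n xs} → T (inP7 n xs) →
        sum xs ≡ n × P7Symbol (durfee xs ∸ 1) (p7G xs) (p7D xs)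
                   × p7Partition (durfee xs ∸ 1) (p7G xs) (p7D xs) ≡ xs
inP7⇒ {n} {xs} t =
  let p0 , t₁ = T-∧⁻ t
      isPart , _ = T-∧⁻ p0
      sum≡n , positive , descending = isPartitionOf⇒ isPart
      1≤j′ , t₂ = T-∧⁻ t₁
      ℓγ≡ℓδ , t₃ = T-∧⁻ t₂
      γ₁≡j , t₄ = T-∧⁻ t₃
      γ₂<γ₁ , t₅ = T-∧⁻ t₄
      δ₁≡j′ , δ≢2 = T-∧⁻ t₅
      open P7SymbolOf {xs} descending positive (≤ᵇ⇒≤ 1 _ 1≤j′) (≡ᵇ⇒≡ _ _ ℓγ≡ℓδ) (≡ᵇ⇒≡ _ _ γ₁≡j)
             (<ᵇ⇒< _ _ γ₂<γ₁) (≡ᵇ⇒≡ _ _ δ₁≡j′) (to (notAny≡ᵇ⇔All≢ 2 _) δ≢2)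
  in sum≡n , symbol , p7Partition-symbol

P7Symbol⇒IsDurfeeSymbol : ∀ {j G D} → P7Symbol j G D → IsDurfeeSymbol (suc j) (j ∷ G) (suc j ∷ D)
P7Symbol⇒IsDurfeeSymbol {j} s = record
  { α-descending = All.map <⇒≤ G<j ∷ G-descending
  ; α-positive = <-≤-trans z<s 2≤j ∷ G-positive
  ; α-≤ = n≤1+n j ∷ All.map (λ g<j → ≤-trans (<⇒≤ g<j) (n≤1+n j)) G<j
  ; β-descending = D≤1+j ∷ D-descending
  ; β-positive = z<s ∷ D-positive
  ; β-≤ = ≤-refl ∷ D≤1+j
  }
  where open P7Symbol s

module P7Partition {j G D} (s : P7Symbol j G D) where
  open P7Symbol s
  open FromDurfeeSymbol z<s (P7Symbol⇒IsDurfeeSymbol s)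

  durfee∸1-p7Partition : durfee xs ∸ 1 ≡ j
  durfee∸1-p7Partition = cong (_∸ 1) durfee-fromDurfeeSymbol

  p7G-p7Partition : p7G xs ≡ G
  p7G-p7Partition = cong (drop 1) durfeeα-fromDurfeeSymbol

  p7D-p7Partition : p7D xs ≡ D
  p7D-p7Partition = cong (drop 1) durfeeβ-fromDurfeeSymbol

  inP7-p7Partition : T (inP7 (sum xs) xs)
  inP7-p7Partition =
    T-∧⁺ (T-∧⁺ (isPartitionOf⇐ refl positive descending) (≤⇒≤ᵇ (≤-reflexive ℓ≡λ₁)))
    (T-∧⁺ (≤⇒≤ᵇ 0<j′) (T-∧⁺ (≡⇒≡ᵇ _ _ ℓγ≡ℓδ) (T-∧⁺ (≡⇒≡ᵇ _ _ γ₁≡j) (T-∧⁺ (<⇒<ᵇ γ₂<γ₁)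
    (T-∧⁺ (≡⇒≡ᵇ _ _ δ₁≡j′) (from (notAny≡ᵇ⇔All≢ 2 _) δ≢2))))))
    where
      γ≡ : durfeeα xs ≡ j ∷ G
      γ≡ = durfeeα-fromDurfeeSymbol
      δ≡ : durfeeβ xs ≡ suc j ∷ D
      δ≡ = durfeeβ-fromDurfeeSymbol
      j′≡ : durfee xs ≡ suc j
      j′≡ = durfee-fromDurfeeSymbol
      ℓ≡λ₁ : length xs ≡ part xs 1
      ℓ≡λ₁ = trans length-fromDurfeeSymbol
               (trans (cong (λ ℓ → suc j + suc ℓ) (sym ℓG≡ℓD)) (sym part₁-fromDurfeeSymbol))
      0<j′ : 0 < durfee xs
      0<j′ = subst (0 <_) (sym j′≡) z<s
      ℓγ≡ℓδ : length (durfeeα xs) ≡ length (durfeeβ xs)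
      ℓγ≡ℓδ = trans (cong length γ≡) (trans (cong suc ℓG≡ℓD) (sym (cong length δ≡)))
      γ₁≡j : part (durfeeα xs) 1 ≡ durfee xs ∸ 1
      γ₁≡j = trans (cong (λ γ → part γ 1) γ≡) (sym durfee∸1-p7Partition)
      head<j : ∀ {ys} → All (_< j) ys → part ys 1 < j
      head<j [] = <-≤-trans z<s 2≤j
      head<j (y<j ∷ _) = y<j
      γ₂<γ₁ : part (durfeeα xs) 2 < part (durfeeα xs) 1
      γ₂<γ₁ = subst (λ γ → part γ 2 < part γ 1) (sym γ≡) (head<j G<j)
      δ₁≡j′ : part (durfeeβ xs) 1 ≡ durfee xs
      δ₁≡j′ = trans (cong (λ δ → part δ 1) δ≡) (sym j′≡)
      δ≢2 : All (_≢ 2) (durfeeβ xs)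
      δ≢2 = subst (All (_≢ 2)) (sym δ≡) (>⇒≢ (s≤s 2≤j) ∷ D≢2)

-- The bijection of symbols

padOnes : ℕ → List ℕ → List ℕ
padOnes m xs = xs ++ replicate (m ∸ length xs) 1

stripOnes : List ℕ → List ℕ
stripOnes = filter (2 ≤?_)

length-padOnes : ∀ {m} xs → length xs ≤ m → length (padOnes m xs) ≡ m
length-padOnes {m} xs ℓ≤m =
  trans (length-++ xs) (trans (cong (length xs +_) (length-replicate (m ∸ length xs))) (m+[n∸m]≡n ℓ≤m))

sum-replicate-1 : ∀ k → sum (replicate k 1) ≡ k
sum-replicate-1 zero = refl
sum-replicate-1 (suc k) = cong suc (sum-replicate-1 k)

sum-padOnes : ∀ m xs → sum (padOnes m xs) ≡ sum xs + (m ∸ length xs)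
sum-padOnes m xs = trans (sum-++ xs _) (cong (sum xs +_) (sum-replicate-1 (m ∸ length xs)))

sum-map-suc : ∀ xs → sum (map suc xs) ≡ sum xs + length xs
sum-map-suc [] = refl
sum-map-suc (x ∷ xs) = trans (cong (suc x +_) (sum-map-suc xs)) (regroup x (sum xs) (length xs))
  where
    regroup : ∀ a b c → suc a + (b + c) ≡ a + b + suc c
    regroup = solve-∀

sum-map-pred : ∀ {xs} → Positive xs → sum (map pred xs) + length xs ≡ sum xs
sum-map-pred {[]} [] = refl
sum-map-pred {suc x ∷ xs} (_ ∷ pos) = trans (+-suc (x + sum (map pred xs)) (length xs))
  (cong suc (trans (+-assoc x _ _) (cong (x +_) (sum-map-pred pos))))

map-pred-suc : ∀ xs → map pred (map suc xs) ≡ xs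
map-pred-suc xs = trans (sym (map-∘ xs)) (map-id xs)

map-suc-pred : ∀ {xs} → Positive xs → map suc (map pred xs) ≡ xs
map-suc-pred [] = refl
map-suc-pred {suc x ∷ xs} (_ ∷ pos) = cong (suc x ∷_) (map-suc-pred pos)

2≰1 : ¬ 2 ≤ 1
2≰1 (s≤s ())

stripOnes-padOnes : ∀ {m xs} → All (2 ≤_) xs → stripOnes (padOnes m xs) ≡ xs
stripOnes-padOnes {m} {xs} 2≤xs = begin
  stripOnes (xs ++ ones)           ≡⟨ filter-++ (2 ≤?_) xs ones ⟩
  stripOnes xs ++ stripOnes ones   ≡⟨ cong₂ _++_ (filter-all (2 ≤?_) 2≤xs)
                                                  (filter-none (2 ≤?_) (All.replicate⁺ (m ∸ length xs) 2≰1)) ⟩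
  xs ++ []                         ≡⟨ ++-identityʳ xs ⟩
  xs                               ∎
  where
    ones : List ℕ
    ones = replicate (m ∸ length xs) 1

-- The 1s of a descending positive list form its tail.
padOnes-stripOnes : ∀ {xs} → Descending xs → Positive xs → padOnes (length xs) (stripOnes xs) ≡ xs
padOnes-stripOnes {[]} _ _ = refl
padOnes-stripOnes {suc (suc x) ∷ xs} (_ ∷ desc) (_ ∷ pos) =
  trans (cong (padOnes (suc (length xs))) (filter-accept (2 ≤?_) {suc (suc x)} {xs} (s≤s (s≤s z≤n))))
        (cong (suc (suc x) ∷_) (padOnes-stripOnes desc pos))
padOnes-stripOnes {1 ∷ xs} (xs≤1 ∷ desc) (_ ∷ pos) = begin
  padOnes (suc ℓ) (stripOnes (1 ∷ xs))   ≡⟨ cong (padOnes (suc ℓ)) (filter-reject (2 ≤?_) {1} {xs} 2≰1) ⟩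
  padOnes (suc ℓ) (stripOnes xs)         ≡⟨ cong (padOnes (suc ℓ)) noneStripped ⟩
  1 ∷ padOnes ℓ []                       ≡⟨ cong (λ ys → 1 ∷ padOnes ℓ ys) (sym noneStripped) ⟩
  1 ∷ padOnes ℓ (stripOnes xs)           ≡⟨ cong (1 ∷_) (padOnes-stripOnes desc pos) ⟩
  1 ∷ xs                                 ∎
  where
    ℓ : ℕ
    ℓ = length xs
    noneStripped : stripOnes xs ≡ []
    noneStripped = filter-none (2 ≤?_) (All.map (λ y≤1 → <⇒≱ (s≤s y≤1)) xs≤1)

Qbar4→P7Symbol : ∀ {j A B} → Qbar4Symbol j A B → P7Symbol j (map pred B) (padOnes (length B) (map suc A))
Qbar4→P7Symbol {j} {A} {B} s = record
  { 2≤j = 2≤j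
  ; G-descending = AllPairs.map⁺ (AllPairs.map pred-mono-≤ B-descending)
  ; G-positive = All.map⁺ (All.map pred-mono-≤ 2≤B)
  ; G<j = All.map⁺ (All.zipWith pred< (2≤B , B≤j))
  ; D-descending = AllPairs.++⁺ (AllPairs.map⁺ (AllPairs.map s≤s A-descending)) (ones-descending _)
                     (All.map⁺ (All.universal (λ _ → All.replicate⁺ _ (s≤s z≤n)) A))
  ; D-positive = All.++⁺ (All.map⁺ (All.universal (λ _ → z<s) A)) (All.replicate⁺ _ z<s)
  ; D≤1+j = All.++⁺ (All.map⁺ (All.map s≤s A≤j)) (All.replicate⁺ _ (s≤s z≤n))
  ; D≢2 = All.++⁺ (All.map⁺ (All.map (λ 2≤a → >⇒≢ (s≤s 2≤a)) 2≤A)) (All.replicate⁺ _ λ ())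
  ; ℓG≡ℓD = trans (length-map pred B)
              (sym (length-padOnes (map suc A) (subst (_≤ length B) (sym (length-map suc A)) ℓA≤ℓB)))
  }
  where
    open Qbar4Symbol s
    pred< : ∀ {b} → 2 ≤ b × b ≤ j → pred b < j
    pred< {suc b} (_ , b<j) = b<j
    ones-descending : ∀ k → Descending (replicate k 1)
    ones-descending zero = []
    ones-descending (suc k) = All.replicate⁺ k ≤-refl ∷ ones-descending k

P7→Qbar4Symbol : ∀ {j G D} → P7Symbol j G D → Qbar4Symbol j (map pred (stripOnes D)) (map suc G)
P7→Qbar4Symbol {j} {G} {D} s = record
  { 2≤j = 2≤j
  ; A-descending = AllPairs.map⁺ (AllPairs.map pred-mono-≤ (AllPairs.filter⁺ (2 ≤?_) D-descending))
  ; 2≤A = All.map⁺ (All.zipWith 2≤pred (All.all-filter (2 ≤?_) D , All.filter⁺ (2 ≤?_) D≢2))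
  ; A≤j = All.map⁺ (All.map pred-mono-≤ (All.filter⁺ (2 ≤?_) D≤1+j))
  ; B-descending = AllPairs.map⁺ (AllPairs.map s≤s G-descending)
  ; 2≤B = All.map⁺ (All.map s≤s G-positive)
  ; B≤j = All.map⁺ G<j
  ; ℓA≤ℓB = subst₂ _≤_ (sym (length-map pred (stripOnes D)))
                       (trans (sym ℓG≡ℓD) (sym (length-map suc G)))
                       (length-filter (2 ≤?_) D)
  }
  where
    open P7Symbol s
    2≤pred : ∀ {d} → 2 ≤ d × d ≢ 2 → 2 ≤ pred d
    2≤pred {1} (s≤s () , _)
    2≤pred {2} (_ , 2≢2) = contradiction refl 2≢2
    2≤pred {suc (suc (suc d))} _ = s≤s (s≤s z≤n)

p7FromQbar4Symbol : ℕ → List ℕ → List ℕ → List ℕ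
p7FromQbar4Symbol j A B = p7Partition j (map pred B) (padOnes (length B) (map suc A))

qbar4FromP7Symbol : ℕ → List ℕ → List ℕ → List ℕ
qbar4FromP7Symbol j G D = qbar4Partition j (map pred (stripOnes D)) (map suc G)

sum-p7FromQbar4Symbol : ∀ {j A B} → Qbar4Symbol j A B →
                        sum (p7FromQbar4Symbol j A B) ≡ sum (qbar4Partition j A B)
sum-p7FromQbar4Symbol {j} {A} {B} s = begin
  sum (p7Partition j (map pred B) D)
    ≡⟨ FromDurfeeSymbol.sum-fromDurfeeSymbol z<s (P7Symbol⇒IsDurfeeSymbol (Qbar4→P7Symbol s)) ⟩
  suc j * suc j + (j + sum (map pred B)) + (suc j + sum D)
    ≡⟨ cong (λ d → suc j * suc j + (j + sum (map pred B)) + (suc j + d)) sum-D ⟩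
  suc j * suc j + (j + sum (map pred B)) + (suc j + (sum A + length B))
    ≡⟨ regroup j (sum A) (sum (map pred B)) (length B) ⟩
  j * j + (j + (j + sum A)) + (j + (j + (sum (map pred B) + length B + 2)))
    ≡⟨ cong (λ b → j * j + (j + (j + sum A)) + (j + (j + (b + 2))))
            (sum-map-pred (All.map (<-≤-trans z<s) 2≤B)) ⟩
  j * j + (j + (j + sum A)) + (j + (j + (sum B + 2)))
    ≡⟨ cong (λ b → j * j + (j + (j + sum A)) + (j + (j + b))) (sym (sum-++ B (2 ∷ []))) ⟩
  j * j + (j + (j + sum A)) + (j + (j + sum (B ∷ʳ 2)))
    ≡⟨ sym (FromDurfeeSymbol.sum-fromDurfeeSymbol (<-≤-trans z<s 2≤j) (Qbar4Symbol⇒IsDurfeeSymbol s)) ⟩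
  sum (qbar4Partition j A B) ∎
  where
    open Qbar4Symbol s
    D : List ℕ
    D = padOnes (length B) (map suc A)
    sum-D : sum D ≡ sum A + length B
    sum-D = begin
      sum D
        ≡⟨ sum-padOnes (length B) (map suc A) ⟩
      sum (map suc A) + (length B ∸ length (map suc A))
        ≡⟨ cong₂ _+_ (sum-map-suc A) (cong (length B ∸_) (length-map suc A)) ⟩
      sum A + length A + (length B ∸ length A)
        ≡⟨ +-assoc (sum A) _ _ ⟩
      sum A + (length A + (length B ∸ length A))
        ≡⟨ cong (sum A +_) (m+[n∸m]≡n ℓA≤ℓB) ⟩
      sum A + length B ∎
    regroup : ∀ j a g b → suc j * suc j + (j + g) + (suc j + (a + b))
                        ≡ j * j + (j + (j + a)) + (j + (j + (g + b + 2)))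
    regroup = solve-∀

qbar4FromP7-p7FromQbar4 : ∀ {j A B} → Qbar4Symbol j A B →
  qbar4FromP7Symbol j (map pred B) (padOnes (length B) (map suc A)) ≡ qbar4Partition j A B
qbar4FromP7-p7FromQbar4 {j} {A} {B} s = cong₂ (qbar4Partition j)
  (trans (cong (map pred) (stripOnes-padOnes (All.map⁺ (All.map (s≤s ∘ <-≤-trans z<s) 2≤A))))
         (map-pred-suc A))
  (map-suc-pred (All.map (<-≤-trans z<s) 2≤B))
  where open Qbar4Symbol s

p7FromQbar4-qbar4FromP7 : ∀ {j G D} → P7Symbol j G D →
  p7FromQbar4Symbol j (map pred (stripOnes D)) (map suc G) ≡ p7Partition j G D
p7FromQbar4-qbar4FromP7 {j} {G} {D} s = begin
  p7Partition j (map pred (map suc G)) (padOnes (length (map suc G)) (map suc (map pred (stripOnes D))))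
    ≡⟨ cong₂ (p7Partition j) (map-pred-suc G)
         (cong₂ padOnes (trans (length-map suc G) ℓG≡ℓD)
                        (map-suc-pred (All.map (<-≤-trans z<s) (All.all-filter (2 ≤?_) D)))) ⟩
  p7Partition j G (padOnes (length D) (stripOnes D))
    ≡⟨ cong (p7Partition j G) (padOnes-stripOnes D-descending D-positive) ⟩
  p7Partition j G D ∎
  where open P7Symbol s

qbar4→p7 : List ℕ → List ℕ
qbar4→p7 xs = p7FromQbar4Symbol (durfee xs) (qbar4A xs) (qbar4B xs)

p7→qbar4 : List ℕ → List ℕ
p7→qbar4 ys = qbar4FromP7Symbol (durfee ys ∸ 1) (p7G ys) (p7D ys)

qbar4→p7-qbar4Partition : ∀ {j A B} → Qbar4Symbol j A B →
                          qbar4→p7 (qbar4Partition j A B) ≡ p7FromQbar4Symbol j A B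
qbar4→p7-qbar4Partition s =
  cong₃ p7FromQbar4Symbol durfee-qbar4Partition qbar4A-qbar4Partition qbar4B-qbar4Partition
  where open Qbar4Partition s

p7→qbar4-p7Partition : ∀ {j G D} → P7Symbol j G D →
                       p7→qbar4 (p7Partition j G D) ≡ qbar4FromP7Symbol j G D
p7→qbar4-p7Partition s = cong₃ qbar4FromP7Symbol durfee∸1-p7Partition p7G-p7Partition p7D-p7Partition
  where open P7Partition s

qbar4→p7-inP7 : ∀ {n xs} → T (inQbar4 n xs) → T (inP7 n (qbar4→p7 xs))
qbar4→p7-inP7 {n} {xs} t with inQbar4⇒ {n} {xs} t
... | sum≡n , s , qbar4Partition≡xs = subst (λ m → T (inP7 m (qbar4→p7 xs)))
  (trans (sum-p7FromQbar4Symbol s) (trans (cong sum qbar4Partition≡xs) sum≡n))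
  (P7Partition.inP7-p7Partition (Qbar4→P7Symbol s))

p7→qbar4-inQbar4 : ∀ {n ys} → T (inP7 n ys) → T (inQbar4 n (p7→qbar4 ys))
p7→qbar4-inQbar4 {n} {ys} t with inP7⇒ {n} {ys} t
... | sum≡n , s , p7Partition≡ys = subst (λ m → T (inQbar4 m (p7→qbar4 ys)))
  (trans (sym (sum-p7FromQbar4Symbol (P7→Qbar4Symbol s)))
         (trans (cong sum (trans (p7FromQbar4-qbar4FromP7 s) p7Partition≡ys)) sum≡n))
  (Qbar4Partition.inQbar4-qbar4Partition (P7→Qbar4Symbol s))

p7→qbar4∘qbar4→p7 : ∀ {n xs} → T (inQbar4 n xs) → p7→qbar4 (qbar4→p7 xs) ≡ xs
p7→qbar4∘qbar4→p7 {n} {xs} t with inQbar4⇒ {n} {xs} t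
... | _ , s , qbar4Partition≡xs = begin
  p7→qbar4 (qbar4→p7 xs)
    ≡⟨ p7→qbar4-p7Partition (Qbar4→P7Symbol s) ⟩
  qbar4FromP7Symbol (durfee xs) (map pred (qbar4B xs)) (padOnes (length (qbar4B xs)) (map suc (qbar4A xs)))
    ≡⟨ qbar4FromP7-p7FromQbar4 s ⟩
  qbar4Partition (durfee xs) (qbar4A xs) (qbar4B xs)
    ≡⟨ qbar4Partition≡xs ⟩
  xs ∎

qbar4→p7∘p7→qbar4 : ∀ {n ys} → T (inP7 n ys) → qbar4→p7 (p7→qbar4 ys) ≡ ys
qbar4→p7∘p7→qbar4 {n} {ys} t with inP7⇒ {n} {ys} t
... | _ , s , p7Partition≡ys = begin
  qbar4→p7 (p7→qbar4 ys)
    ≡⟨ qbar4→p7-qbar4Partition (P7→Qbar4Symbol s) ⟩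
  p7FromQbar4Symbol (durfee ys ∸ 1) (map pred (stripOnes (p7D ys))) (map suc (p7G ys))
    ≡⟨ p7FromQbar4-qbar4FromP7 s ⟩
  p7Partition (durfee ys ∸ 1) (p7G ys) (p7D ys)
    ≡⟨ p7Partition≡ys ⟩
  ys ∎

lemma5p4 : (n : ℕ) → Qbar4 n ⤖ P7 n
lemma5p4 n = ↔⇒⤖ (mk↔ₛ′ forward backward forward∘backward backward∘forward)
  where
    forward : Qbar4 n → P7 n
    forward (xs , t) = qbar4→p7 xs , qbar4→p7-inP7 {n} {xs} t
    backward : P7 n → Qbar4 n
    backward (ys , t) = p7→qbar4 ys , p7→qbar4-inQbar4 {n} {ys} t
    forward∘backward : ∀ y → forward (backward y) ≡ y
    forward∘backward (ys , t) = Σ-≡,≡→≡ (qbar4→p7∘p7→qbar4 {n} {ys} t , T-irrelevant _ _)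
    backward∘forward : ∀ x → backward (forward x) ≡ x
    backward∘forward (xs , t) = Σ-≡,≡→≡ (p7→qbar4∘qbar4→p7 {n} {xs} t , T-irrelevant _ _)
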